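{- Assume that almost all $3K_1$-free graphs have $\chi = \omega$ and almost all $2K_2$-free graphs have $\chi=\omega$. Let $\ell \in \{3,4\}$. Then almost every $C_\ell$-free graph $G$ satisfies $c(G) < \alpha(G)$.
   Context: All graphs are finite and simple. For a graph $H$, a graph $G$ is $H$-free if it has no induced subgraph isomorphic to $H$. $3K_1$ is the edgeless graph on $3$ vertices, $2K_2$ is the disjoint union of two edges, and $C_\ell$ is the cycle on $\ell$ vertices. "Almost every graph in a class $\mathcal{G}$ has property $P$" means that the proportion of $n$-vertex graphs in $\mathcal{G}$ having $P$ tends to $1$ as $n\to\infty$. $\chi$, $\omega$, $\alpha$ denote chromatic number, clique number and independence number. The Cops and Robbers game on $G$: first $m$ cops are placed on vertices, then the robber is placed; players alternate turns starting with the cops; on a turn each cop (resp. the robber) moves to an adjacent vertex or stays. The cops win if after finitely many moves a cop occupies the robber's vertex. The cop number $c(G)$ is the least $m$ such that $m$ cops can always win (for a disconnected graph the game is played on the whole graph). -}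

module Defs where

import Level
open import Data.Nat using (ℕ; zero; suc; _+_; _*_; _≤_; _<_; _≡ᵇ_)
open import Data.Fin using (Fin; toℕ)
open import Data.Bool using (Bool; true; false; _∨_; _∧_)
open import Data.List using (List; length)
open import Data.List.Relation.Unary.All using (All)
open import Data.List.Relation.Unary.AllPairs using (AllPairs)
open import Data.Product using (Σ; ∃; ∃-syntax; _×_; _,_)
open import Data.Sum using (_⊎_)
open import Function.Definitions using (Injective)
open import Relation.Nullary using (¬_)
open import Relation.Binary.PropositionalEquality using (_≡_)

record Graph (n : ℕ) : Set where
  field
    adj    : Fin n → Fin n → Bool
    sym    : ∀ i j → adj i j ≡ adj j i
    irrefl : ∀ i → adj i i ≡ false
open Graph public

_≐_ : ∀ {n} → Graph n → Graph n → Set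
G ≐ H = ∀ i j → adj G i j ≡ adj H i j

InducedCopy : ∀ {h n} → (Fin h → Fin h → Bool) → Graph n → Set
InducedCopy {h} {n} H G =
  Σ (Fin h → Fin n) λ f → Injective _≡_ _≡_ f × (∀ i j → adj G (f i) (f j) ≡ H i j)

Free : ∀ {h} → (Fin h → Fin h → Bool) → ∀ {n} → Graph n → Set
Free H G = ¬ InducedCopy H G

threeK1 : Fin 3 → Fin 3 → Bool
threeK1 _ _ = false

twoK2 : Fin 4 → Fin 4 → Bool
twoK2 i j = ((toℕ i ≡ᵇ 0) ∧ (toℕ j ≡ᵇ 1)) ∨ ((toℕ i ≡ᵇ 1) ∧ (toℕ j ≡ᵇ 0))
          ∨ ((toℕ i ≡ᵇ 2) ∧ (toℕ j ≡ᵇ 3)) ∨ ((toℕ i ≡ᵇ 3) ∧ (toℕ j ≡ᵇ 2))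

-- C_ℓ : cycle 0 - 1 - ... - (ℓ-1) - 0   (used for ℓ ≥ 3)
cycle : (ℓ : ℕ) → Fin ℓ → Fin ℓ → Bool
cycle ℓ i j = (toℕ j ≡ᵇ suc (toℕ i)) ∨ (toℕ i ≡ᵇ suc (toℕ j))
            ∨ ((toℕ i ≡ᵇ 0) ∧ (suc (toℕ j) ≡ᵇ ℓ))
            ∨ ((toℕ j ≡ᵇ 0) ∧ (suc (toℕ i) ≡ᵇ ℓ))

ProperColouring : ∀ {n} → Graph n → (k : ℕ) → (Fin n → Fin k) → Set
ProperColouring G k c = ∀ u v → adj G u v ≡ true → ¬ (c u ≡ c v)

Colourable : ∀ {n} → Graph n → ℕ → Set
Colourable G k = Σ _ λ c → ProperColouring G k c

IsChromaticNumber : ∀ {n} → Graph n → ℕ → Set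
IsChromaticNumber G k = Colourable G k × (∀ j → j < k → ¬ Colourable G j)

HasClique : ∀ {n} → Graph n → ℕ → Set
HasClique {n} G k = Σ (Fin k → Fin n) λ f → Injective _≡_ _≡_ f ×
  (∀ i j → ¬ (i ≡ j) → adj G (f i) (f j) ≡ true)

HasIndependentSet : ∀ {n} → Graph n → ℕ → Set
HasIndependentSet {n} G k = Σ (Fin k → Fin n) λ f → Injective _≡_ _≡_ f ×
  (∀ i j → adj G (f i) (f j) ≡ false)

IsCliqueNumber : ∀ {n} → Graph n → ℕ → Set
IsCliqueNumber G k = HasClique G k × (∀ j → k < j → ¬ HasClique G j)

IsIndependenceNumber : ∀ {n} → Graph n → ℕ → Set
IsIndependenceNumber G k = HasIndependentSet G k × (∀ j → k < j → ¬ HasIndependentSet G j)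

ChiEqOmega : ∀ {n} → Graph n → Set
ChiEqOmega G = ∃[ k ] (IsChromaticNumber G k × IsCliqueNumber G k)

Step : ∀ {n} → Graph n → Fin n → Fin n → Set
Step G u v = u ≡ v ⊎ adj G u v ≡ true

Captured : ∀ {n m} → (Fin m → Fin n) → Fin n → Set
Captured cs r = ∃[ i ] (cs i ≡ r)

-- CopsWinFrom G cs r : cops (at positions cs, to move), robber at r;
-- the cops can force a capture in finitely many moves.
data CopsWinFrom {n m : ℕ} (G : Graph n) (cs : Fin m → Fin n) (r : Fin n) : Set where
  caught : Captured cs r → CopsWinFrom G cs r
  move   : (cs' : Fin m → Fin n) → (∀ i → Step G (cs i) (cs' i)) →
           (Captured cs' r ⊎ (∀ r' → Step G r r' → CopsWinFrom G cs' r')) →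
           CopsWinFrom G cs r

CopsWin : ∀ {n} → Graph n → ℕ → Set
CopsWin {n} G m = Σ (Fin m → Fin n) λ cs → ∀ r → CopsWinFrom G cs r

IsCopNumber : ∀ {n} → Graph n → ℕ → Set
IsCopNumber G c = CopsWin G c × (∀ m → m < c → ¬ CopsWin G m)

CopLessAlpha : ∀ {n} → Graph n → Set
CopLessAlpha G = ∃[ c ] ∃[ a ] (IsCopNumber G c × IsIndependenceNumber G a × c < a)

Distinct : ∀ {n} → List (Graph n) → Set
Distinct {n} L = AllPairs {A = Graph n} (λ (G H : Graph n) → ¬ (G ≐ H)) L

-- The proportion |{G ∈ C_n : P G}| / |C_n| tends to 1, i.e. for every k,
-- for all large n at least (1 - 1/(k+1)) of the n-vertex graphs of C
-- have P.  Stated without decidability: for every list of m distinct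
-- members of C_n there are m' distinct members of C_n with P such that
-- (k+1) m' ≥ k m.  (Taking the list to be all of C_n gives the usual
-- statement; smaller lists are then automatic.)
AlmostAll : (C : ∀ {n} → Graph n → Set) (P : ∀ {n} → Graph n → Set) → Set
AlmostAll C P =
  ∀ (k : ℕ) → ∃[ N ] ∀ n → N ≤ n →
    ∀ (L : List (Graph n)) → Distinct L → All (λ G → C {n} G) L →
      ∃[ L' ] (Distinct L' × All (λ G → C {n} G × P {n} G) L' ×
               suc k * length L ≤ suc k * length L' + length L)

{-# OPTIONS --safe #-}

-- Passing to complements, the hypotheses say that almost every C_ℓ-free graph G is covered by
-- k = α(G) cliques. Guarding each clique, k cops win; we save one cop as soon as some vertex u has
-- two neighbours v, y outside its own clique. If u v lies in no induced C₄ inside the union of the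
-- cliques of u and v, one cop alone holds both cliques: it starts on u and, if the robber sits out
-- of reach, moves to v. For ℓ = 4 this always applies. For ℓ = 3 the cliques have at most two
-- vertices, and if it applies neither to u v nor to u y, then u and its partner dominate all three
-- cliques, so two cops suffice there.
--
-- In the remaining graphs every vertex has at most one neighbour outside its clique, so the graph is
-- determined by two maps Fin n → Fin n, and there are at most n²ⁿ of them. This is negligible against
-- the 2^(⌊n/2⌋²) bipartite (ℓ = 3) or split (ℓ = 4) graphs, which are all C_ℓ-free.
--
-- The cop number itself exists because the set of positions won by the cops is decidable, being the
-- least fixed point of a decidable operator on a finite set.
module Submission where

open import Defs
import Data.Bool.Properties as Bool
import Data.List.Relation.Unary.All.Properties as All
import Data.List.Relation.Unary.AllPairs.Properties as AllPairs
open import Data.Bool using (Bool; true; false; not; _∧_; _∨_)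
open import Data.Empty using (⊥)
open import Data.Fin using (Fin; zero; suc; combine; finToFun; funToFin; inject≤; join; punchIn; punchOut; remQuot; splitAt)
  renaming (_<_ to _<ᶠ_)
open import Data.Fin.Patterns using (0F; 1F; 2F; 3F)
open import Data.Fin.Properties using (_≟_; all?; any?; combine-surjective; finToFun-funToFin; funToFin-finToFin; inject≤-injective; injective⇒≤; join-splitAt; pigeonhole; punchIn-punchOut; remQuot-combine; splitAt-join)
open import Data.Fin.Subset using (Subset; _∉_; _⊂_; _-_; ⊤)
open import Data.Fin.Subset.Induction using (⊂-wellFounded; Acc; acc)
open import Data.Fin.Subset.Properties using (_∈?_; ∈⊤; x∈p⇒p-x⊂p; x∈p∧x≢y⇒x∈p-y)
open import Data.List using (List; []; _∷_; length; lookup; map; tabulate)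
open import Data.List.Membership.Propositional.Properties using (∈-lookup)
open import Data.List.Properties using (length-map; length-tabulate)
open import Data.List.Relation.Unary.All as All using (All; []; _∷_)
open import Data.List.Relation.Unary.AllPairs as AllPairs using (AllPairs; []; _∷_)
open import Data.Nat using (ℕ; zero; suc; _+_; _*_; _∸_; _^_; _≤_; _<_; _≤?_; z≤n; s≤s)
open import Data.Nat.Properties hiding (_≟_)
open import Data.Nat.Solver using (module +-*-Solver)
open import Data.Product using (∃-syntax; _×_; _,_; proj₁; proj₂)
open import Data.Sum using (_⊎_; inj₁; inj₂; map₁)
open import Function using (_∘_; id)
open import Function.Definitions using (Injective)
open import Relation.Binary.PropositionalEquality using (_≡_; _≢_; _≗_; refl; trans; cong; cong₂; subst)
  renaming (sym to ≡-sym)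
open import Relation.Nullary using (¬_; Dec; yes; no; contradiction; does)
open import Relation.Nullary.Decidable using (_×-dec_; _⊎-dec_; _→-dec_; ¬?; dec-false; dec-true; map′; toWitness)
open import Relation.Unary using (Decidable)

-- Deciding the game

module LeastFixedPoint {p : ℕ} (S : Fin p → Set) (T : Subset p → Fin p → Set)
  (T? : ∀ U → Decidable (T U))
  (sound : ∀ U x → (∀ y → y ∉ U → S y) → T U x → S x)
  (complete : ∀ U → (∀ x → T U x → x ∉ U) → ∀ x → S x → x ∉ U) where

  -- Everything outside `U` is already known to satisfy `S`. While some point of `U` satisfies
  -- `T U`, `sound` allows its removal, and this ends since `U` shrinks. Once there is none,
  -- `complete` refutes `S` on all of `U`.
  decide-from : ∀ U → Acc _⊂_ U → (∀ y → y ∉ U → S y) → Decidable S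
  decide-from U (acc rec) out x with any? (λ y → (y ∈? U) ×-dec T? U y)
  ... | yes (y , y∈U , ty) = decide-from (U - y) (rec (x∈p⇒p-x⊂p y∈U)) out′ x
    where
    out′ : ∀ z → z ∉ U - y → S z
    out′ z z∉ with z ≟ y
    ... | yes refl = sound U y out ty
    ... | no z≢y   = out z (λ z∈U → z∉ (x∈p∧x≢y⇒x∈p-y z∈U z≢y))
  ... | no none with x ∈? U
  ... | no x∉U  = yes (out x x∉U)
  ... | yes x∈U = no λ sx → complete U (λ y ty y∈U → none (y , y∈U , ty)) x sx x∈U

  decide : Decidable S
  decide = decide-from ⊤ (⊂-wellFounded ⊤) (λ y y∉⊤ → contradiction ∈⊤ y∉⊤)

step? : ∀ {n} (G : Graph n) u v → Dec (Step G u v)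
step? G u v = (u ≟ v) ⊎-dec (adj G u v Bool.≟ true)

module _ {n m : ℕ} (G : Graph n) where

  captured? : (cs : Fin m → Fin n) → Decidable (Captured cs)
  captured? cs r = any? (λ i → cs i ≟ r)

  -- Coding a tuple of cops as a number and decoding it returns the tuple only up to pointwise
  -- equality, so winning has to be invariant under that.
  CopsWinFrom-resp-≗ : ∀ {cs cs′ : Fin m → Fin n} {r} → cs ≗ cs′ →
                       CopsWinFrom G cs r → CopsWinFrom G cs′ r
  CopsWinFrom-resp-≗ eq (caught (i , p))  = caught (i , trans (≡-sym (eq i)) p)
  CopsWinFrom-resp-≗ eq (move cs″ st win) =
    move cs″ (λ i → subst (λ u → Step G u (cs″ i)) (eq i) (st i)) win

  private
    -- A position of the game, cop tuple together with robber, becomes a single number, so that sets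
    -- of positions are of type `Subset`.
    cops : Fin (n ^ m * n) → Fin m → Fin n
    cops = finToFun ∘ proj₁ ∘ remQuot n

    robber : Fin (n ^ m * n) → Fin n
    robber = proj₂ ∘ remQuot {n ^ m} n

    Wins : Fin (n ^ m * n) → Set
    Wins x = CopsWinFrom G (cops x) (robber x)

    wins-combine : ∀ y r → Wins (combine y r) → CopsWinFrom G (finToFun {n} {m} y) r
    wins-combine y r =
      subst (λ z → CopsWinFrom G (finToFun (proj₁ z)) (proj₂ z)) (remQuot-combine y r)

    -- U is the set of positions not yet known to be winning.
    WinsNext : Subset (n ^ m * n) → Fin (n ^ m * n) → Set
    WinsNext U x = Captured (cops x) (robber x) ⊎
      ∃[ y ] ((∀ i → Step G (cops x i) (finToFun {n} {m} y i)) ×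
              (Captured (finToFun {n} {m} y) (robber x) ⊎
               (∀ r → Step G (robber x) r → combine y r ∉ U)))

    winsNext? : ∀ U → Decidable (WinsNext U)
    winsNext? U x = captured? (cops x) (robber x) ⊎-dec
      any? λ y → all? (λ i → step? G (cops x i) (finToFun y i)) ×-dec
        (captured? (finToFun y) (robber x) ⊎-dec
         all? λ r → step? G (robber x) r →-dec ¬? (combine y r ∈? U))

    sound : ∀ U x → (∀ y → y ∉ U → Wins y) → WinsNext U x → Wins x
    sound U x out (inj₁ c)                   = caught c
    sound U x out (inj₂ (y , st , inj₁ c))   = move (finToFun y) st (inj₁ c)
    sound U x out (inj₂ (y , st , inj₂ win)) =
      move (finToFun y) st (inj₂ λ r s → wins-combine y r (out _ (win r s)))

    module _ (U : Subset (n ^ m * n)) (closed : ∀ x → WinsNext U x → x ∉ U) where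

      -- Induction on the winning strategy. The code `x` varies over all codes of the position,
      -- because the tuple a strategy moves to need not be literally a decoded one.
      complete′ : ∀ {cs r} → CopsWinFrom G cs r → ∀ x → cops x ≗ cs → robber x ≡ r → x ∉ U
      complete′ (caught (i , p)) x ec refl = closed x (inj₁ (i , trans (ec i) p))
      complete′ (move cs′ st win) x ec refl = closed x (inj₂ (y , steps , next win))
        where
        y = funToFin cs′
        y≗ : finToFun y ≗ cs′
        y≗ = finToFun-funToFin cs′
        steps : ∀ i → Step G (cops x i) (finToFun y i)
        steps i rewrite ec i | y≗ i = st i
        next : Captured cs′ (robber x) ⊎ (∀ r → Step G (robber x) r → CopsWinFrom G cs′ r) →
               Captured (finToFun y) (robber x) ⊎ (∀ r → Step G (robber x) r → combine y r ∉ U)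
        next (inj₁ (i , p)) = inj₁ (i , trans (y≗ i) p)
        next (inj₂ w)       = inj₂ λ r s → complete′ (w r s) (combine y r)
          (λ i → trans (cong (λ z → finToFun {n} {m} (proj₁ z) i) (remQuot-combine y r)) (y≗ i))
          (cong proj₂ (remQuot-combine y r))

      complete : ∀ x → Wins x → x ∉ U
      complete x w = complete′ w x (λ _ → refl) refl

    wins? : Decidable Wins
    wins? = LeastFixedPoint.decide Wins WinsNext winsNext? sound complete

  copsWinFrom? : ∀ (cs : Fin m → Fin n) r → Dec (CopsWinFrom G cs r)
  copsWinFrom? cs r = map′
    (CopsWinFrom-resp-≗ y≗ ∘ wins-combine y r)
    (subst (λ z → CopsWinFrom G (finToFun (proj₁ z)) (proj₂ z)) (≡-sym (remQuot-combine y r))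
       ∘ CopsWinFrom-resp-≗ (≡-sym ∘ y≗))
    (wins? (combine y r))
    where
    y = funToFin cs
    y≗ : finToFun y ≗ cs
    y≗ = finToFun-funToFin cs

copsWin? : ∀ {n} (G : Graph n) → Decidable (CopsWin G)
copsWin? G m = map′
  (λ (y , w) → finToFun y , w)
  (λ (cs , w) → funToFin cs , λ r → CopsWinFrom-resp-≗ G (≡-sym ∘ finToFun-funToFin cs) (w r))
  (any? λ y → all? (copsWinFrom? G (finToFun y)))

least : {P : ℕ → Set} → Decidable P → ∀ {m} → P m → ∃[ c ] (P c × (∀ j → j < c → ¬ P j) × c ≤ m)
least P? {zero} p = 0 , p , (λ _ ()) , z≤n
least P? {suc m} p with P? 0
... | yes p₀ = 0 , p₀ , (λ _ ()) , z≤n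
... | no ¬p₀ with c , pc , min , c≤m ← least (P? ∘ suc) p =
  suc c , pc , (λ { zero _ → ¬p₀ ; (suc j) (s≤s j<c) → min j j<c }) , s≤s c≤m

copNumber≤ : ∀ {n} (G : Graph n) {m} → CopsWin G m → ∃[ c ] (IsCopNumber G c × c ≤ m)
copNumber≤ G w with c , wc , min , c≤m ← least (copsWin? G) w = c , (wc , min) , c≤m

-- Saving a cop

adj⇒≢ : ∀ {n} (G : Graph n) {u v} → adj G u v ≡ true → u ≢ v
adj⇒≢ G e refl = contradiction (trans (≡-sym e) (irrefl G _)) λ ()

adj-sym : ∀ {n} (G : Graph n) {u v b} → adj G u v ≡ b → adj G v u ≡ b
adj-sym G e = trans (sym G _ _) e

NoTriangle NoInducedC₄ : ∀ {n} → Graph n → Set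
NoTriangle G = ∀ {u v w} → adj G u v ≡ true → adj G v w ≡ true → adj G u w ≡ true → ⊥
NoInducedC₄ G = ∀ {a b c d} → a ≢ c → b ≢ d →
  adj G a b ≡ true → adj G b c ≡ true → adj G c d ≡ true → adj G d a ≡ true →
  adj G a c ≡ false → adj G b d ≡ false → ⊥

module _ {n : ℕ} (G : Graph n) where

  capture : ∀ {m} {cs : Fin m → Fin n} {r} i → Step G (cs i) r → CopsWinFrom G cs r
  capture {cs = cs} {r} i s = move cs′ steps (inj₁ (i , at-i))
    where
    cs′ : Fin _ → Fin n
    cs′ j with j ≟ i
    ... | yes _ = r
    ... | no _  = cs j
    steps : ∀ j → Step G (cs j) (cs′ j)
    steps j with j ≟ i
    ... | yes refl = s
    ... | no _     = inj₁ refl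
    at-i : cs′ i ≡ r
    at-i with i ≟ i
    ... | yes _  = refl
    ... | no i≢i = contradiction refl i≢i

module CliqueCover {n k : ℕ} (G : Graph n) (c : Fin n → Fin (suc k))
  (clique : ∀ {u v} → c u ≡ c v → Step G u v) where

  rep : Fin n → Fin (suc k) → Fin n
  rep u d with any? (λ v → c v ≟ d)
  ... | yes (v , _) = v
  -- Clique `d` is empty, so the robber never stands in it and any post will do.
  ... | no _        = u

  rep-step : ∀ u r → Step G (rep u (c r)) r
  rep-step u r with any? (λ v → c v ≟ c r)
  ... | yes (_ , e) = clique e
  ... | no none     = contradiction (r , refl) none

  _[_↦_] : (Fin (suc k) → Fin n) → Fin (suc k) → Fin n → Fin (suc k) → Fin n
  (f [ d ↦ u ]) e with e ≟ d
  ... | yes _ = u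
  ... | no _  = f e

  update-same : ∀ f d u → (f [ d ↦ u ]) d ≡ u
  update-same f d u with d ≟ d
  ... | yes _  = refl
  ... | no d≢d = contradiction refl d≢d

  update-other : ∀ f {d e} u → e ≢ d → (f [ d ↦ u ]) e ≡ f e
  update-other f {d} {e} u e≢d with e ≟ d
  ... | yes p = contradiction p e≢d
  ... | no _  = refl

  -- The posts `f` provide one cop per clique. Dropping the cop of clique `q` leaves `k` of them.
  guards : (Fin (suc k) → Fin n) → Fin (suc k) → Fin k → Fin n
  guards f q = f ∘ punchIn q

  guard-captures : ∀ f {q d r} → q ≢ d → Step G (f d) r → CopsWinFrom G (guards f q) r
  guard-captures f {q} q≢d s = capture G (punchOut q≢d)
    (subst (λ e → Step G (f e) _) (≡-sym (punchIn-punchOut q≢d)) s)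

  -- One cop handles the cliques of u and v: it starts on u and answers by moving to v.
  two-cliques : ∀ {u v} → adj G u v ≡ true → c u ≢ c v →
    (∀ r w → c r ≡ c v → c w ≡ c u → adj G r w ≡ true → adj G u r ≡ true ⊎ adj G v w ≡ true) →
    CopsWin G k
  two-cliques {u} {v} uv cu≢cv no-C₄ = guards f (c v) , play
    where
    f g : Fin (suc k) → Fin n
    f = rep u [ c u ↦ u ]
    g = rep u [ c u ↦ v ]

    f-step : ∀ r → Step G (f (c r)) r
    f-step r with c r ≟ c u
    ... | yes p = clique (≡-sym p)
    ... | no _  = rep-step u r

    f⇒g : ∀ d → Step G (f d) (g d)
    f⇒g d with d ≟ c u
    ... | yes _ = inj₂ uv
    ... | no _  = inj₁ refl

    v-captures : ∀ {r} → Step G v r → CopsWinFrom G (guards g (c v)) r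
    v-captures {r} s = guard-captures g (cu≢cv ∘ ≡-sym)
      (subst (λ x → Step G x r) (≡-sym (update-same (rep u) (c u) v)) s)

    -- The robber sat in the clique of `v` out of reach of `u`, and the cop from `u` is now on `v`.
    -- Staying in that clique exposes the robber to `v`, and a third clique has its own guard. In
    -- the clique of `u`, the assumption `no-C₄` makes the robber's new vertex adjacent to `v`.
    reply : ∀ {r} → c r ≡ c v → adj G u r ≡ false → ∀ r′ → Step G r r′ →
            CopsWinFrom G (guards g (c v)) r′
    reply {r} cr≡cv ur r′ s with c v ≟ c r′
    ... | yes p = v-captures (clique p)
    ... | no cv≢cr′ with c r′ ≟ c u
    ...   | no p = guard-captures g cv≢cr′
      (subst (λ x → Step G x r′) (≡-sym (update-other (rep u) v p)) (rep-step u r′))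
    ...   | yes cr′≡cu with s
    ...     | inj₁ refl = contradiction (≡-sym cr≡cv) cv≢cr′
    ...     | inj₂ rr′ with no-C₄ r r′ cr≡cv cr′≡cu rr′
    ...       | inj₁ ur′ = contradiction (trans (≡-sym ur) ur′) λ ()
    ...       | inj₂ vr′ = v-captures (inj₂ vr′)

    play : ∀ r → CopsWinFrom G (guards f (c v)) r
    play r with c v ≟ c r
    ... | no p = guard-captures f p (f-step r)
    ... | yes p with adj G u r in ur
    ...   | true  = guard-captures f (cu≢cv ∘ ≡-sym)
      (subst (λ x → Step G x r) (≡-sym (update-same (rep u) (c u) u)) (inj₂ ur))
    ...   | false = move (guards g (c v)) (λ i → f⇒g (punchIn (c v) i))
      (inj₂ (reply (≡-sym p) ur))

  -- If `r w` violated the condition of `two-cliques`, then `u`, `v`, `r`, `w` would be an induced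
  -- C₄ in this order. The degenerate cases `r = v` and `w = u` satisfy the condition through the
  -- edge `u v`.
  C₄-free-wins : NoInducedC₄ G → ∀ {u v} → adj G u v ≡ true → c u ≢ c v → CopsWin G k
  C₄-free-wins no-C₄ {u} {v} uv cu≢cv = two-cliques uv cu≢cv dominated
    where
    dominated : ∀ r w → c r ≡ c v → c w ≡ c u → adj G r w ≡ true →
                adj G u r ≡ true ⊎ adj G v w ≡ true
    dominated r w cr cw rw with adj G u r in ur | adj G v w in vw
    ... | true  | _     = inj₁ refl
    ... | false | true  = inj₂ refl
    ... | false | false with clique (≡-sym cr) | clique cw
    ...   | inj₁ refl | _         = contradiction (trans (≡-sym uv) ur) λ ()
    ...   | inj₂ _    | inj₁ refl = contradiction (trans (≡-sym (adj-sym G uv)) vw) λ ()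
    ...   | inj₂ vr   | inj₂ wu   = contradiction vw
      (no-C₄ (λ { refl → cu≢cv cr }) (λ { refl → cu≢cv (≡-sym cw) }) uv vr rw wu ur)

  module TriangleFree (no-triangle : NoTriangle G) where

    clique-≤2 : ∀ {x y z} → x ≢ y → c x ≡ c y → c y ≡ c z → z ≡ x ⊎ z ≡ y
    clique-≤2 x≢y cxy cyz with clique cxy | clique cyz | clique (trans cxy cyz)
    ... | inj₁ x≡y | _        | _        = contradiction x≡y x≢y
    ... | inj₂ _   | inj₁ y≡z | _        = inj₂ (≡-sym y≡z)
    ... | inj₂ _   | inj₂ _   | inj₁ x≡z = inj₁ (≡-sym x≡z)
    ... | inj₂ xy  | inj₂ yz  | inj₂ xz  = contradiction xz (no-triangle xy yz)

    -- For an edge `u v` between two cliques, this is an induced C₄ on `u`, `v`, `r`, `w` whose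
    -- sides `v r` and `w u` lie inside the cliques. It is exactly what violates the condition of
    -- `two-cliques`.
    Crossing : Fin n → Fin n → Fin n → Fin n → Set
    Crossing u v r w = c r ≡ c v × c w ≡ c u × adj G r w ≡ true × adj G u r ≡ false × adj G v w ≡ false

    crossing? : ∀ u v → Dec (∃[ r ] ∃[ w ] Crossing u v r w)
    crossing? u v = any? λ r → any? λ w →
      (c r ≟ c v) ×-dec (c w ≟ c u) ×-dec (adj G r w Bool.≟ true) ×-dec
      (adj G u r Bool.≟ false) ×-dec (adj G v w Bool.≟ false)

    wins-or-crossing : ∀ {u v} → adj G u v ≡ true → c u ≢ c v →
                       CopsWin G k ⊎ (∃[ r ] ∃[ w ] Crossing u v r w)
    wins-or-crossing {u} {v} uv cu≢cv with crossing? u v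
    ... | yes p   = inj₂ p
    ... | no none = inj₁ (two-cliques uv cu≢cv dominated)
      where
      dominated : ∀ r w → c r ≡ c v → c w ≡ c u → adj G r w ≡ true →
                  adj G u r ≡ true ⊎ adj G v w ≡ true
      dominated r w cr cw rw with adj G u r in ur | adj G v w in vw
      ... | true  | _     = inj₁ refl
      ... | false | true  = inj₂ refl
      ... | false | false = contradiction (r , w , cr , cw , rw , ur , vw) none

    -- The clique of `v` consists of `v` and `r` only; `u` is adjacent to the first and `w` to the
    -- second.
    crossing-dominates : ∀ {u v r w} → adj G u v ≡ true → Crossing u v r w →
                         ∀ {t} → c v ≡ c t → Step G u t ⊎ Step G w t
    crossing-dominates {u} {v} {r} uv (cr , _ , rw , ur , _) cvt
      with clique-≤2 {v} {r} v≢r (≡-sym cr) (trans cr cvt)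
      where
      v≢r : v ≢ r
      v≢r refl = contradiction (trans (≡-sym uv) ur) λ ()
    ... | inj₁ refl = inj₁ (inj₂ uv)
    ... | inj₂ refl = inj₂ (inj₂ (adj-sym G rw))

    crossing-≢ : ∀ {u v r w} → adj G u v ≡ true → Crossing u v r w → u ≢ w
    crossing-≢ uv (_ , _ , _ , _ , vw) refl =
      contradiction (trans (≡-sym (adj-sym G uv)) vw) λ ()

    -- If neither pair of cliques can be held by one cop, u and its partner w dominate the three cliques of u, v and y.
    wins : ∀ {u v y} → v ≢ y → adj G u v ≡ true → adj G u y ≡ true →
           c u ≢ c v → c u ≢ c y → CopsWin G k
    wins {u} {v} {y} v≢y uv uy cu≢cv cu≢cy with wins-or-crossing uv cu≢cv | wins-or-crossing uy cu≢cy
    ... | inj₁ win | _ = win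
    ... | inj₂ _ | inj₁ win = win
    -- Both `w` and `w′` are partners of `u` in a clique of at most two vertices, hence equal.
    ... | inj₂ (r , w , cross) | inj₂ (r′ , w′ , cross′)
      with clique-≤2 (crossing-≢ uv cross) (≡-sym (proj₁ (proj₂ cross)))
             (trans (proj₁ (proj₂ cross)) (≡-sym (proj₁ (proj₂ cross′))))
    ...   | inj₁ w′≡u = contradiction (≡-sym w′≡u) (crossing-≢ uy cross′)
    ...   | inj₂ refl = guards f (c y) , play
      where
      cv≢cy : c v ≢ c y
      cv≢cy p with clique p
      ... | inj₁ q  = v≢y q
      ... | inj₂ vy = no-triangle uv vy uy

      f : Fin (suc k) → Fin n
      -- The cop responsible for the clique of `v` is posted on `w`, and the one of the clique of
      -- `y` is dropped.
      f = (rep u [ c v ↦ w ]) [ c u ↦ u ]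

      u-captures : ∀ {t} → Step G u t → CopsWinFrom G (guards f (c y)) t
      u-captures {t} s = guard-captures f (cu≢cy ∘ ≡-sym)
        (subst (λ x → Step G x t) (≡-sym (update-same _ (c u) u)) s)

      w-captures : ∀ {t} → Step G w t → CopsWinFrom G (guards f (c y)) t
      w-captures {t} s = guard-captures f (cv≢cy ∘ ≡-sym)
        (subst (λ x → Step G x t) (≡-sym (trans (update-other _ u (cu≢cv ∘ ≡-sym)) (update-same _ (c v) w))) s)

      u-or-w : ∀ {t} → Step G u t ⊎ Step G w t → CopsWinFrom G (guards f (c y)) t
      u-or-w (inj₁ s) = u-captures s
      u-or-w (inj₂ s) = w-captures s

      play : ∀ t → CopsWinFrom G (guards f (c y)) t
      play t with c y ≟ c t | c v ≟ c t | c u ≟ c t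
      ... | yes p | _     | _     = u-or-w (crossing-dominates uy cross′ p)
      ... | no _  | yes p | _     = u-or-w (crossing-dominates uv cross p)
      ... | no _  | no _  | yes p = u-captures (clique p)
      ... | no y≢ | no v≢ | no u≢ = guard-captures f y≢ (subst (λ x → Step G x t)
        (≡-sym (trans (update-other _ u (u≢ ∘ ≡-sym)) (update-other _ w (v≢ ∘ ≡-sym)))) (rep-step u t))

-- Complements

co : ∀ {n} → (Fin n → Fin n → Bool) → Fin n → Fin n → Bool
co M i j = not (does (i ≟ j)) ∧ not (M i j)

co-diag : ∀ {n} (M : Fin n → Fin n → Bool) i → co M i i ≡ false
co-diag M i = cong (λ b → not b ∧ _) (dec-true (i ≟ i) refl)

co-off : ∀ {n} (M : Fin n → Fin n → Bool) {i j} → i ≢ j → co M i j ≡ not (M i j)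
co-off M i≢j = cong (λ b → not b ∧ _) (dec-false (_ ≟ _) i≢j)

co-pullback : ∀ {h n} {f : Fin h → Fin n} → Injective _≡_ _≡_ f →
  ∀ {K M} → (∀ i j → M (f i) (f j) ≡ K i j) → ∀ i j → co M (f i) (f j) ≡ co K i j
co-pullback {f = f} inj {K} {M} eq i j with i ≟ j
... | yes refl = co-diag M (f i)
... | no i≢j   = trans (co-off M (i≢j ∘ inj)) (cong not (eq i j))

complement : ∀ {n} → Graph n → Graph n
adj (complement G) = co (adj G)
sym (complement G) i j with i ≟ j
... | yes refl = ≡-sym (co-diag (adj G) i)
... | no i≢j   = trans (cong not (sym G i j)) (≡-sym (co-off (adj G) (i≢j ∘ ≡-sym)))
irrefl (complement G) = co-diag (adj G)

complement-involutive : ∀ {n} (G : Graph n) → complement (complement G) ≐ G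
complement-involutive G i j with i ≟ j
... | yes refl = ≡-sym (irrefl G i)
... | no i≢j   = Bool.not-involutive _

complement-injective : ∀ {n} {G H : Graph n} → complement G ≐ complement H → G ≐ H
complement-injective {G = G} {H} eq i j =
  trans (≡-sym (complement-involutive G i j))
    (trans (cong (λ b → not (does (i ≟ j)) ∧ not b) (eq i j)) (complement-involutive H i j))

complements-distinct : ∀ {n} {L : List (Graph n)} → Distinct L → Distinct (map complement L)
complements-distinct = AllPairs.map⁺ ∘ AllPairs.map λ {G} {H} G≄H → G≄H ∘ complement-injective {G = G} {H}

-- The relabelling `σ` is there because the complement of C₄ is 2K₂ with its vertices in a different
-- order.
InducedCopy-complement : ∀ {h n} {K K′ : Fin h → Fin h → Bool} {G : Graph n} (σ : Fin h → Fin h) →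
  Injective _≡_ _≡_ σ → (∀ i j → co K′ (σ i) (σ j) ≡ K i j) →
  InducedCopy K′ G → InducedCopy K (complement G)
InducedCopy-complement {G = G} σ σ-inj eq (f , inj , copy) =
  f ∘ σ , σ-inj ∘ inj , λ i j → trans (co-pullback inj {M = adj G} copy (σ i) (σ j)) (eq i j)

-- A copy of `K′` in the complement yields a copy of `K` in the double complement, which has the
-- adjacencies of `G`.
Free-complement : ∀ {h n} {K K′ : Fin h → Fin h → Bool} {G : Graph n} (σ : Fin h → Fin h) →
  Injective _≡_ _≡_ σ → (∀ i j → co K′ (σ i) (σ j) ≡ K i j) →
  Free K G → Free K′ (complement G)
Free-complement {G = G} σ σ-inj eq free copy′
  with f , inj , copy ← InducedCopy-complement {G = complement G} σ σ-inj eq copy′ =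
  free (f , inj , λ i j → trans (≡-sym (complement-involutive G (f i) (f j))) (copy i j))

threeK1⇒cycle3 : ∀ {n} {G : Graph n} → Free threeK1 G → Free (cycle 3) (complement G)
threeK1⇒cycle3 {G = G} = Free-complement {G = G} id id
  (toWitness {a? = all? λ i → all? λ j → _ Bool.≟ _} _)

cycle3⇒threeK1 : ∀ {n} {G : Graph n} → Free (cycle 3) G → Free threeK1 (complement G)
cycle3⇒threeK1 {G = G} = Free-complement {G = G} id id
  (toWitness {a? = all? λ i → all? λ j → _ Bool.≟ _} _)

-- The complement of the cycle 0-1-2-3 has the edges 02 and 13.
swap₁₂ : Fin 4 → Fin 4
swap₁₂ 0F = 0F
swap₁₂ 1F = 2F
swap₁₂ 2F = 1F
swap₁₂ 3F = 3F

swap₁₂-injective : Injective _≡_ _≡_ swap₁₂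
swap₁₂-injective {i} {j} eq = trans (≡-sym (inv i)) (trans (cong swap₁₂ eq) (inv j))
  where
  inv : ∀ i → swap₁₂ (swap₁₂ i) ≡ i
  inv = toWitness {a? = all? λ i → _ ≟ _} _

twoK2⇒cycle4 : ∀ {n} {G : Graph n} → Free twoK2 G → Free (cycle 4) (complement G)
twoK2⇒cycle4 {G = G} = Free-complement {G = G} swap₁₂ swap₁₂-injective
  (toWitness {a? = all? λ i → all? λ j → _ Bool.≟ _} _)

cycle4⇒twoK2 : ∀ {n} {G : Graph n} → Free (cycle 4) G → Free twoK2 (complement G)
cycle4⇒twoK2 {G = G} = Free-complement {G = G} swap₁₂ swap₁₂-injective
  (toWitness {a? = all? λ i → all? λ j → _ Bool.≟ _} _)

module _ {n : ℕ} (G : Graph n) where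

  NoTriangle⇒Free : NoTriangle G → Free (cycle 3) G
  NoTriangle⇒Free nt (f , _ , e) = nt (e 0F 1F) (e 1F 2F) (e 0F 2F)

  NoInducedC₄⇒Free : NoInducedC₄ G → Free (cycle 4) G
  NoInducedC₄⇒Free no-C₄ (f , inj , e) =
    no-C₄ (λ p → contradiction (inj p) λ ()) (λ p → contradiction (inj p) λ ())
      (e 0F 1F) (e 1F 2F) (e 2F 3F) (e 3F 0F) (e 0F 2F) (e 1F 3F)

  Free⇒NoTriangle : Free (cycle 3) G → NoTriangle G
  Free⇒NoTriangle free {u} {v} {w} uv vw uw = free (f , inj , e)
    where
    f : Fin 3 → Fin n
    f 0F = u
    f 1F = v
    f 2F = w
    e : ∀ i j → adj G (f i) (f j) ≡ cycle 3 i j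
    e 0F 0F = irrefl G u
    e 0F 1F = uv
    e 0F 2F = uw
    e 1F 0F = adj-sym G uv
    e 1F 1F = irrefl G v
    e 1F 2F = vw
    e 2F 0F = adj-sym G uw
    e 2F 1F = adj-sym G vw
    e 2F 2F = irrefl G w
    inj : Injective _≡_ _≡_ f
    inj {0F} {0F} _ = refl
    inj {1F} {1F} _ = refl
    inj {2F} {2F} _ = refl
    inj {0F} {1F} p = contradiction p (adj⇒≢ G uv)
    inj {0F} {2F} p = contradiction p (adj⇒≢ G uw)
    inj {1F} {2F} p = contradiction p (adj⇒≢ G vw)
    inj {1F} {0F} p = contradiction (≡-sym p) (adj⇒≢ G uv)
    inj {2F} {0F} p = contradiction (≡-sym p) (adj⇒≢ G uw)
    inj {2F} {1F} p = contradiction (≡-sym p) (adj⇒≢ G vw)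

  Free⇒NoInducedC₄ : Free (cycle 4) G → NoInducedC₄ G
  Free⇒NoInducedC₄ free {a} {b} {c} {d} a≢c b≢d ab bc cd da ac bd = free (f , inj , e)
    where
    f : Fin 4 → Fin n
    f 0F = a
    f 1F = b
    f 2F = c
    f 3F = d
    e : ∀ i j → adj G (f i) (f j) ≡ cycle 4 i j
    e 0F 0F = irrefl G a
    e 0F 1F = ab
    e 0F 2F = ac
    e 0F 3F = adj-sym G da
    e 1F 0F = adj-sym G ab
    e 1F 1F = irrefl G b
    e 1F 2F = bc
    e 1F 3F = bd
    e 2F 0F = adj-sym G ac
    e 2F 1F = adj-sym G bc
    e 2F 2F = irrefl G c
    e 2F 3F = cd
    e 3F 0F = da
    e 3F 1F = adj-sym G bd
    e 3F 2F = adj-sym G cd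
    e 3F 3F = irrefl G d
    inj : Injective _≡_ _≡_ f
    inj {0F} {0F} _ = refl
    inj {1F} {1F} _ = refl
    inj {2F} {2F} _ = refl
    inj {3F} {3F} _ = refl
    inj {0F} {1F} p = contradiction p (adj⇒≢ G ab)
    inj {0F} {2F} p = contradiction p a≢c
    inj {0F} {3F} p = contradiction (≡-sym p) (adj⇒≢ G da)
    inj {1F} {0F} p = contradiction (≡-sym p) (adj⇒≢ G ab)
    inj {1F} {2F} p = contradiction p (adj⇒≢ G bc)
    inj {1F} {3F} p = contradiction p b≢d
    inj {2F} {0F} p = contradiction (≡-sym p) a≢c
    inj {2F} {1F} p = contradiction (≡-sym p) (adj⇒≢ G bc)
    inj {2F} {3F} p = contradiction p (adj⇒≢ G cd)
    inj {3F} {0F} p = contradiction p (adj⇒≢ G da)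
    inj {3F} {1F} p = contradiction (≡-sym p) b≢d
    inj {3F} {2F} p = contradiction (≡-sym p) (adj⇒≢ G cd)

complement-independence : ∀ {n k} (G : Graph n) → IsCliqueNumber G k →
                          IsIndependenceNumber (complement G) k
complement-independence {k = k} G ((f , inj , clique) , max) =
  (f , inj , indep) , λ { j k<j (g , g-inj , g-indep) → max j k<j (g , g-inj , g-clique g-inj g-indep) }
  where
  indep : ∀ i j → co (adj G) (f i) (f j) ≡ false
  indep i j with i ≟ j
  ... | yes refl = co-diag (adj G) (f i)
  ... | no i≢j   = trans (co-off (adj G) (i≢j ∘ inj)) (cong not (clique i j i≢j))
  g-clique : ∀ {j} {g : Fin j → Fin _} → Injective _≡_ _≡_ g →
             (∀ x y → co (adj G) (g x) (g y) ≡ false) → ∀ x y → x ≢ y → adj G (g x) (g y) ≡ true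
  g-clique g-inj g-indep x y x≢y = Bool.not-injective
    (trans (≡-sym (co-off (adj G) (x≢y ∘ g-inj))) (g-indep x y))

colour-class-clique : ∀ {n k} (G : Graph n) {c : Fin n → Fin k} → ProperColouring G k c →
                      ∀ {u v} → c u ≡ c v → Step (complement G) u v
colour-class-clique G proper {u} {v} eq with u ≟ v
... | yes p = inj₁ p
... | no _ with adj G u v in uv
...   | true  = contradiction eq (proper u v uv)
...   | false = inj₂ refl

-- Graphs in which every vertex has at most one neighbour outside its clique

-- Here `c` labels the cliques and `q` points from each vertex to its neighbour outside its clique.
-- Labels are taken from `Fin n`, whatever the number of cliques, so that the number of codes
-- depends on `n` alone.
decode : ∀ {n} → (Fin n → Fin n) → (Fin n → Fin n) → Fin n → Fin n → Bool
decode c q u v = not (does (u ≟ v)) ∧ (does (c u ≟ c v) ∨ does (q u ≟ v))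

decodePair : ∀ {n} → Fin (n ^ n) × Fin (n ^ n) → Fin n → Fin n → Bool
decodePair (x , y) = decode (finToFun x) (finToFun y)

decodeFin : ∀ {n} → Fin (n ^ n * n ^ n) → Fin n → Fin n → Bool
decodeFin {n} x = decodePair (remQuot (n ^ n) x)

decodeFin-combine : ∀ {n} (c q : Fin n → Fin n) u v →
                    decodeFin (combine (funToFin c) (funToFin q)) u v ≡ decode c q u v
decodeFin-combine c q u v = trans
  (cong (λ z → decodePair z u v) (remQuot-combine (funToFin c) (funToFin q))) decoded
  where
  decoded : decodePair (funToFin c , funToFin q) u v ≡ decode c q u v
  decoded rewrite finToFun-funToFin c u | finToFun-funToFin c v | finToFun-funToFin q u = refl

Coded : ∀ {n} → Graph n → Set
Coded G = ∃[ x ] (∀ u v → adj G u v ≡ decodeFin x u v)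

module _ {n : ℕ} (G : Graph n) (c : Fin n → Fin n) (clique : ∀ {u v} → c u ≡ c v → Step G u v)
  (unique : ∀ {u v y} → v ≢ y → adj G u v ≡ true → adj G u y ≡ true → c u ≢ c v → c u ≢ c y → ⊥) where

  outer : Fin n → Fin n
  outer u with any? (λ v → (adj G u v Bool.≟ true) ×-dec ¬? (c u ≟ c v))
  ... | yes (v , _) = v
  -- Pointing to itself records that `u` has no outside neighbour, since `decode` excludes the
  -- diagonal.
  ... | no _        = u

  outer-spec : ∀ {u v} → u ≢ v → c u ≢ c v → adj G u v ≡ does (outer u ≟ v)
  outer-spec {u} {v} u≢v cu≢cv with any? (λ v → (adj G u v Bool.≟ true) ×-dec ¬? (c u ≟ c v))
  ... | no none = trans (Bool.¬-not (λ uv → none (v , uv , cu≢cv))) (≡-sym (dec-false (u ≟ v) u≢v))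
  ... | yes (y , uy , cu≢cy) with y ≟ v
  ...   | yes refl = uy
  ...   | no y≢v   = Bool.¬-not (λ uv → unique y≢v uy uv cu≢cy cu≢cv)

  adj≡decode : ∀ u v → adj G u v ≡ decode c outer u v
  adj≡decode u v with u ≟ v
  ... | yes refl = irrefl G u
  ... | no u≢v with c u ≟ c v
  ...   | no cu≢cv = outer-spec u≢v cu≢cv
  ...   | yes cu≡cv with clique cu≡cv
  ...     | inj₁ p  = contradiction p u≢v
  ...     | inj₂ uv = uv

  coded : Coded G
  coded = combine (funToFin c) (funToFin outer) ,
    λ u v → trans (adj≡decode u v) (≡-sym (decodeFin-combine c outer u v))

-- The one fact about the game for which ℓ = 3 and ℓ = 4 need separate arguments.
SavesCop : (∀ {n} → Graph n → Set) → Set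
SavesCop C = ∀ {n k} (G : Graph n) → C G → (c : Fin n → Fin (suc k)) →
  (∀ {u v} → c u ≡ c v → Step G u v) → ∀ {u v y} → v ≢ y → adj G u v ≡ true → adj G u y ≡ true →
  c u ≢ c v → c u ≢ c y → CopsWin G k

-- The classes of an optimal colouring of `H` are cliques of the complement, and their number is its
-- independence number because χ = ω. A search for a vertex with two neighbours outside its clique
-- decides the alternative.
cop<α-or-coded : ∀ {C : ∀ {n} → Graph n → Set} → SavesCop C → ∀ {n} (H : Graph n) →
  C (complement H) → ChiEqOmega H → CopLessAlpha (complement H) ⊎ Coded (complement H)
-- A colouring with no colours means that there are no vertices.
cop<α-or-coded wins H CG (zero , ((c , _) , _) , _) =
  inj₂ (coded (complement H) id (λ {u} → contradiction (c u) λ ()) (λ {u} → contradiction (c u) λ ()))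
cop<α-or-coded wins {n} H CG (suc k , ((c , proper) , _) , ω)
  with any? (λ u → any? λ v → any? λ y → ¬? (v ≟ y) ×-dec (adj (complement H) u v Bool.≟ true)
    ×-dec (adj (complement H) u y Bool.≟ true) ×-dec ¬? (c u ≟ c v) ×-dec ¬? (c u ≟ c y))
... | yes (u , v , y , v≢y , uv , uy , cu≢cv , cu≢cy)
  with d , copNumber , d≤k ← copNumber≤ (complement H)
         (wins (complement H) CG c (colour-class-clique H proper) v≢y uv uy cu≢cv cu≢cy) =
  inj₁ (d , suc k , copNumber , complement-independence H ω , s≤s d≤k)
... | no none = inj₂ (coded (complement H) (embed ∘ c) (colour-class-clique H proper ∘ embed-inj)
  λ v≢y uv uy p q → none (_ , _ , _ , v≢y , uv , uy , p ∘ cong embed , q ∘ cong embed))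
  where
  -- A largest clique of `H` has as many vertices as there are colours, so the colours fit into
  -- `Fin n`.
  k≤n : suc k ≤ n
  k≤n = injective⇒≤ (proj₁ (proj₂ (proj₁ ω)))
  embed : Fin (suc k) → Fin n
  embed d = inject≤ d k≤n
  embed-inj : Injective _≡_ _≡_ embed
  embed-inj = inject≤-injective k≤n k≤n _ _

cycle3-wins : SavesCop (Free (cycle 3))
cycle3-wins G free c clique = CliqueCover.TriangleFree.wins G c clique (Free⇒NoTriangle G free)

cycle4-wins : SavesCop (Free (cycle 4))
cycle4-wins G free c clique _ uv _ cu≢cv _ =
  CliqueCover.C₄-free-wins G c clique (Free⇒NoInducedC₄ G free) uv cu≢cv

-- Counting

AllPairs-lookup : ∀ {A : Set} {R : A → A → Set} {xs : List A} → AllPairs R xs →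
                  ∀ {i j} → i <ᶠ j → R (lookup xs i) (lookup xs j)
AllPairs-lookup (px ∷ _)  {zero}  {suc j} _         = All.lookup px (∈-lookup j)
AllPairs-lookup (_ ∷ pxs) {suc i} {suc j} (s≤s i<j) = AllPairs-lookup pxs i<j

-- The last clause hands any `All` property of the list to both halves; the recursion uses it to
-- keep the pairwise relation.
partition : ∀ {A : Set} {R : A → A → Set} {P Q : A → Set} {xs : List A} →
  AllPairs R xs → All (λ x → P x ⊎ Q x) xs →
  ∃[ ys ] ∃[ zs ] (AllPairs R ys × AllPairs R zs × All P ys × All Q zs ×
    length xs ≡ length ys + length zs × (∀ {S : A → Set} → All S xs → All S ys × All S zs))
partition [] [] = [] , [] , [] , [] , [] , [] , refl , λ _ → [] , []
partition (rx ∷ rxs) (px ∷ pxs)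
  with ys , zs , rys , rzs , pys , qzs , len , res ← partition rxs pxs | px
... | inj₁ p = _ ∷ ys , zs , proj₁ (res rx) ∷ rys , rzs , p ∷ pys , qzs , cong suc len ,
  λ { (s ∷ ss) → s ∷ proj₁ (res ss) , proj₂ (res ss) }
... | inj₂ q = ys , _ ∷ zs , rys , proj₂ (res rx) ∷ rzs , pys , q ∷ qzs ,
  trans (cong suc len) (≡-sym (+-suc _ _)) ,
  λ { (s ∷ ss) → proj₁ (res ss) , s ∷ proj₂ (res ss) }

-- With more graphs than codes, two of them would share a code and so have the same adjacencies.
coded-length : ∀ {n} (L : List (Graph n)) → Distinct L → All Coded L → length L ≤ n ^ n * n ^ n
coded-length {n} L distinct codes = ≮⇒≥ λ too-long →
  let i , j , i<j , eq = pigeonhole too-long (proj₁ ∘ code) in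
  AllPairs-lookup distinct i<j λ u v → trans (proj₂ (code i) u v)
    (trans (cong (λ x → decodeFin x u v) eq) (≡-sym (proj₂ (code j) u v)))
  where
  code : ∀ i → Coded (lookup L i)
  code i = All.lookup codes (∈-lookup i)

-- Many bipartite and many split graphs

bit : Fin 2 → Bool
bit 0F = false
bit 1F = true

bit-injective : ∀ {x y} → bit x ≡ bit y → x ≡ y
bit-injective {0F} {0F} _ = refl
bit-injective {1F} {1F} _ = refl
bit-injective {0F} {1F} ()
bit-injective {1F} {0F} ()

matrix : ∀ {a} → Fin (2 ^ (a * a)) → Fin a → Fin a → Bool
matrix x i j = bit (finToFun x (combine i j))

funToFin-cong : ∀ {m n} {f g : Fin m → Fin n} → (∀ i → f i ≡ g i) → funToFin f ≡ funToFin g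
funToFin-cong {zero}  eq = refl
funToFin-cong {suc m} eq = cong₂ combine (eq zero) (funToFin-cong (eq ∘ suc))

matrix-injective : ∀ {a} {x y : Fin (2 ^ (a * a))} → (∀ i j → matrix x i j ≡ matrix y i j) → x ≡ y
matrix-injective {a} {x} {y} eq = trans (≡-sym (funToFin-finToFin {a * a} x))
  (trans (funToFin-cong same) (funToFin-finToFin {a * a} y))
  where
  same : ∀ e → finToFun {2} {a * a} x e ≡ finToFun y e
  same e with i , j , refl ← combine-surjective {a} {a} e = bit-injective (eq i j)

module _ (a r : ℕ) where

  -- clq tells whether the first part is a clique (split graphs) or not (bipartite graphs).
  partAdj : Bool → (Fin a → Fin a → Bool) → (x y : Fin a ⊎ (Fin a ⊎ Fin r)) → Bool
  partAdj clq M (inj₂ _)        (inj₂ _)        = false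
  partAdj clq M (inj₁ i)        (inj₁ j)        = clq ∧ not (does (i ≟ j))
  partAdj clq M (inj₁ i)        (inj₂ (inj₁ j)) = M i j
  partAdj clq M (inj₂ (inj₁ j)) (inj₁ i)        = M i j
  -- The last `r` vertices are isolated and only bring the order up to `n`.
  partAdj clq M (inj₁ _)        (inj₂ (inj₂ _)) = false
  partAdj clq M (inj₂ (inj₂ _)) (inj₁ _)        = false

  part : Fin (a + (a + r)) → Fin a ⊎ (Fin a ⊎ Fin r)
  part x with splitAt a x
  ... | inj₁ i = inj₁ i
  ... | inj₂ y = inj₂ (splitAt a y)

  part-surjective : ∀ p → ∃[ x ] part x ≡ p
  part-surjective (inj₁ i) = join a (a + r) (inj₁ i) , eq
    where
    eq : part (join a (a + r) (inj₁ i)) ≡ inj₁ i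
    eq rewrite splitAt-join a (a + r) (inj₁ i) = refl
  part-surjective (inj₂ p) = join a (a + r) (inj₂ (join a r p)) , eq
    where
    eq : part (join a (a + r) (inj₂ (join a r p))) ≡ inj₂ p
    eq rewrite splitAt-join a (a + r) (inj₂ (join a r p)) = cong inj₂ (splitAt-join a r p)

  partAdj-sym : ∀ clq M x y → partAdj clq M x y ≡ partAdj clq M y x
  partAdj-sym clq M (inj₁ i) (inj₁ j) = cong (λ b → clq ∧ not b) (does-≟-sym i j)
    where
    does-≟-sym : ∀ i j → does (i ≟ j) ≡ does (j ≟ i)
    does-≟-sym i j with j ≟ i
    ... | yes refl = dec-true (i ≟ i) refl
    ... | no j≢i   = dec-false (i ≟ j) (j≢i ∘ ≡-sym)
  partAdj-sym clq M (inj₁ _)        (inj₂ (inj₁ _)) = refl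
  partAdj-sym clq M (inj₁ _)        (inj₂ (inj₂ _)) = refl
  partAdj-sym clq M (inj₂ (inj₁ _)) (inj₁ _)        = refl
  partAdj-sym clq M (inj₂ (inj₂ _)) (inj₁ _)        = refl
  partAdj-sym clq M (inj₂ _)        (inj₂ _)        = refl

  partAdj-irrefl : ∀ clq M x → partAdj clq M x x ≡ false
  partAdj-irrefl clq M (inj₁ i) =
    trans (cong (λ b → clq ∧ not b) (dec-true (i ≟ i) refl)) (Bool.∧-zeroʳ clq)
  partAdj-irrefl clq M (inj₂ _) = refl

  partGraph : Bool → (Fin a → Fin a → Bool) → Graph (a + (a + r))
  adj    (partGraph clq M) x y = partAdj clq M (part x) (part y)
  sym    (partGraph clq M) x y = partAdj-sym clq M (part x) (part y)
  irrefl (partGraph clq M) x   = partAdj-irrefl clq M (part x)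

  -- The matrix can be read off the edges between the first two blocks.
  partGraph-injective : ∀ clq {M N} → partGraph clq M ≐ partGraph clq N → ∀ i j → M i j ≡ N i j
  partGraph-injective clq eq i j
    with x , px ← part-surjective (inj₁ i) | y , py ← part-surjective (inj₂ (inj₁ j))
    with e ← eq x y rewrite px | py = e

  -- Every edge changes sides, so after two edges one is back on the starting side and the third
  -- edge cannot exist.
  bipartite-triangle-free : ∀ M → NoTriangle (partGraph false M)
  bipartite-triangle-free M {u} {v} {w} uv vw uw = go (part u) (part v) (part w) uv vw uw
    where
    go : ∀ x y z → partAdj false M x y ≡ true → partAdj false M y z ≡ true →
         partAdj false M x z ≡ true → ⊥
    go (inj₁ _)        (inj₂ (inj₁ _)) (inj₁ _)        _ _ ()
    go (inj₂ (inj₁ _)) (inj₁ _)        (inj₂ (inj₁ _)) _ _ ()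

  data Outside : Fin a ⊎ (Fin a ⊎ Fin r) → Set where
    outside : ∀ {y} → Outside (inj₂ y)

  outside-nonadjacent : ∀ M {x y} → Outside x → Outside y → partAdj true M x y ≡ true → ⊥
  outside-nonadjacent M outside outside ()

  nonadjacent-outside : ∀ M {u v} → u ≢ v → adj (partGraph true M) u v ≡ false →
                      Outside (part u) ⊎ Outside (part v)
  nonadjacent-outside M {u} {v} u≢v uv with splitAt a u in eu | splitAt a v in ev
  ... | inj₂ _ | _      = inj₁ outside
  ... | inj₁ _ | inj₂ _ = inj₂ outside
  ... | inj₁ i | inj₁ j with i ≟ j
  ...   | no _     = contradiction uv λ ()
  ...   | yes refl = contradiction (trans (≡-sym (join-splitAt a (a + r) u))
    (trans (cong (join a (a + r)) (trans eu (≡-sym ev))) (join-splitAt a (a + r) v))) u≢v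

  -- Two opposite vertices of an induced C₄ are not both in the clique,
  -- so two consecutive ones are outside.
  split-C₄-free : ∀ M → NoInducedC₄ (partGraph true M)
  split-C₄-free M {x} {y} {z} {w} x≢z y≢w xy yz zw wx xz yw
    with nonadjacent-outside M {x} {z} x≢z xz | nonadjacent-outside M {y} {w} y≢w yw
  ... | inj₁ p | inj₁ q = outside-nonadjacent M p q xy
  ... | inj₁ p | inj₂ q = outside-nonadjacent M q p wx
  ... | inj₂ p | inj₁ q = outside-nonadjacent M q p yz
  ... | inj₂ p | inj₂ q = outside-nonadjacent M p q zw

  partGraphs : Bool → List (Graph (a + (a + r)))
  partGraphs clq = tabulate (partGraph clq ∘ matrix)

  partGraphs-distinct : ∀ clq → Distinct (partGraphs clq)
  partGraphs-distinct clq = AllPairs.tabulate⁺ λ x≢y eq →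
    x≢y (matrix-injective (partGraph-injective clq eq))

ManyGraphs : (∀ {n} → Graph n → Set) → Set
ManyGraphs C = ∀ a r → ∃[ L ] (Distinct {a + (a + r)} L × All C L × length L ≡ 2 ^ (a * a))

many-cycle3-free : ManyGraphs (Free (cycle 3))
many-cycle3-free a r = partGraphs a r false , partGraphs-distinct a r false ,
  All.tabulate⁺ (λ x → NoTriangle⇒Free (partGraph a r false (matrix x))
    λ {u} {v} {w} → bipartite-triangle-free a r (matrix x) {u} {v} {w}) ,
  length-tabulate _

many-cycle4-free : ManyGraphs (Free (cycle 4))
many-cycle4-free a r = partGraphs a r true , partGraphs-distinct a r true ,
  All.tabulate⁺ (λ x → NoInducedC₄⇒Free (partGraph a r true (matrix x)) (split-C₄-free a r (matrix x))) ,
  length-tabulate _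

-- Arithmetic estimates

halve : ∀ n → ∃[ a ] ∃[ r ] (n ≡ a + (a + r) × r ≤ 1)
halve zero          = 0 , 0 , refl , z≤n
halve (suc zero)    = 0 , 1 , refl , ≤-refl
halve (suc (suc n)) with a , r , eq , r≤1 ← halve n =
  suc a , r , cong suc (trans (cong suc eq) (≡-sym (+-suc a (a + r)))) , r≤1

half-large : ∀ {s a r} → r ≤ 1 → s + s ≤ a + (a + r) → s ≤ a
half-large {s} {a} {r} r≤1 2s≤n = ≮⇒≥ λ a<s → <⇒≱
  (begin-strict
    a + (a + r)   ≤⟨ +-monoʳ-≤ a (+-monoʳ-≤ a r≤1) ⟩
    a + (a + 1)   ≡⟨ cong (a +_) (+-comm a 1) ⟩
    a + suc a     <⟨ +-mono-<-≤ a<s a<s ⟩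
    s + s         ∎) 2s≤n
  where open ≤-Reasoning

^-distribʳ-* : ∀ o m n → (m * n) ^ o ≡ m ^ o * n ^ o
^-distribʳ-* zero    m n = refl
^-distribʳ-* (suc o) m n = trans (cong (m * n *_) (^-distribʳ-* o m n))
  ([m*n]*[o*p]≡[m*o]*[n*p] m n (m ^ o) (n ^ o))

-- (x + 2) / x ≤ 8 / 7 and 8⁴ ≤ 2 · 7⁴.
fourth-power-step : ∀ x → 14 ≤ x → (x + 2) ^ 4 ≤ 2 * x ^ 4
fourth-power-step x 14≤x = *-cancelˡ-≤ (7 ^ 4) (begin
  7 ^ 4 * (x + 2) ^ 4  ≡⟨ ^-distribʳ-* 4 7 (x + 2) ⟨
  (7 * (x + 2)) ^ 4    ≤⟨ ^-monoˡ-≤ 4 bound ⟩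
  (8 * x) ^ 4          ≡⟨ ^-distribʳ-* 4 8 x ⟩
  8 ^ 4 * x ^ 4        ≤⟨ *-monoˡ-≤ (x ^ 4) (toWitness {a? = 8 ^ 4 ≤? 7 ^ 4 * 2} _) ⟩
  7 ^ 4 * 2 * x ^ 4    ≡⟨ *-assoc (7 ^ 4) 2 (x ^ 4) ⟩
  7 ^ 4 * (2 * x ^ 4)  ∎)
  where
  open ≤-Reasoning
  bound : 7 * (x + 2) ≤ 8 * x
  bound = begin
    7 * (x + 2)  ≡⟨ *-distribˡ-+ 7 x 2 ⟩
    7 * x + 14   ≤⟨ +-monoʳ-≤ (7 * x) 14≤x ⟩
    7 * x + x    ≡⟨ +-comm (7 * x) x ⟩
    8 * x        ∎

-- With a = t + 24 this reads (2a + 1)⁴ ≤ 2^(a - 1). It holds at a = 24, and raising a by one at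
-- most doubles the left side.
fourth-power-bound : ∀ t → (t + t + 49) ^ 4 ≤ 2 ^ (t + 23)
fourth-power-bound zero    = toWitness {a? = 49 ^ 4 ≤? 2 ^ 23} _
fourth-power-bound (suc t) = begin
  (suc t + suc t + 49) ^ 4  ≡⟨ cong (_^ 4) (solve 1
    (λ t → con 1 :+ t :+ (con 1 :+ t) :+ con 49 := t :+ t :+ con 49 :+ con 2) refl t) ⟩
  (t + t + 49 + 2) ^ 4      ≤⟨ fourth-power-step (t + t + 49)
    (≤-trans (toWitness {a? = 14 ≤? 49} _) (m≤n+m 49 (t + t))) ⟩
  2 * (t + t + 49) ^ 4      ≤⟨ *-monoʳ-≤ 2 (fourth-power-bound t) ⟩
  2 ^ (suc t + 23)          ∎
  where
  open ≤-Reasoning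
  open +-*-Solver

-- With M = 2a + 1 the left side is at most M^(4a + 3), hence at most (M⁴)^(a + 1). By
-- `fourth-power-bound` this is at most 2^((a - 1)(a + 1)), whose exponent is a² - 1.
codes-bound : ∀ {a n K} → 24 ≤ a → n ≤ suc (a + a) → K ≤ suc (a + a) →
              K * (n ^ n * n ^ n) ≤ 2 ^ (a * a)
codes-bound {a} {n} {K} 24≤a n≤M K≤M = begin
  K * (n ^ n * n ^ n)    ≤⟨ *-mono-≤ K≤M (*-mono-≤ nⁿ≤Mᴹ nⁿ≤Mᴹ) ⟩
  M * (M ^ M * M ^ M)    ≡⟨ cong (M *_) (^-distribˡ-+-* M M M) ⟨
  M ^ suc (M + M)        ≤⟨ ^-monoʳ-≤ M exponent ⟩
  M ^ (4 * suc a)        ≡⟨ ^-*-assoc M 4 (suc a) ⟨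
  (M ^ 4) ^ suc a        ≤⟨ ^-monoˡ-≤ (suc a) M⁴≤ ⟩
  (2 ^ (t + 23)) ^ suc a ≡⟨ ^-*-assoc 2 (t + 23) (suc a) ⟩
  2 ^ ((t + 23) * suc a) ≤⟨ ^-monoʳ-≤ 2 square ⟩
  2 ^ (a * a)            ∎
  where
  open ≤-Reasoning
  open +-*-Solver
  t = a ∸ 24
  a≡ : t + 24 ≡ a
  a≡ = m∸n+n≡m 24≤a
  M = suc (a + a)
  nⁿ≤Mᴹ : n ^ n ≤ M ^ M
  nⁿ≤Mᴹ = ≤-trans (^-monoˡ-≤ n n≤M) (^-monoʳ-≤ M n≤M)
  exponent : suc (M + M) ≤ 4 * suc a
  exponent = ≤-trans (n≤1+n _) (≤-reflexive (solve 1
    (λ a → con 1 :+ (con 1 :+ (con 1 :+ (a :+ a) :+ (con 1 :+ (a :+ a)))) := con 4 :* (con 1 :+ a)) refl a))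
  M⁴≤ : M ^ 4 ≤ 2 ^ (t + 23)
  M⁴≤ = subst (λ x → x ^ 4 ≤ 2 ^ (t + 23))
    (trans (solve 1 (λ t → t :+ t :+ con 49 := con 1 :+ (t :+ con 24 :+ (t :+ con 24))) refl t)
      (cong (λ x → suc (x + x)) a≡))
    (fourth-power-bound t)
  square : (t + 23) * suc a ≤ a * a
  square = subst (λ x → (t + 23) * suc x ≤ x * x) a≡ (≤-trans (n≤1+n _) (≤-reflexive (solve 1
    (λ t → con 1 :+ (t :+ con 23) :* (con 1 :+ (t :+ con 24)) := (t :+ con 24) :* (t :+ con 24)) refl t)))

-- Here m = |L|, e is the size of a list E of C-graphs containing at least as many graphs as L, s that
-- of the list the hypothesis yields for E, and B bounds the number of exceptional graphs in the latter.
proportion : ∀ k {m e s g B} → m ≤ e → (2 * suc k) * B ≤ e → s ≤ g + B →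
  (2 * suc k) * e ≤ (2 * suc k) * s + e → suc k * m ≤ suc k * g + m
proportion k {m} {e} {s} {g} {B} m≤e KB≤e s≤g+B hyp = begin
  suc k * m      ≡⟨⟩
  m + k * m      ≤⟨ +-monoʳ-≤ m (*-monoʳ-≤ k m≤e) ⟩
  m + k * e      ≤⟨ +-monoʳ-≤ m ke≤ ⟩
  m + suc k * g  ≡⟨ +-comm m (suc k * g) ⟩
  suc k * g + m  ∎
  where
  open ≤-Reasoning
  open +-*-Solver
  -- After multiplication by 2(k + 1) the permitted loss is 2e: one e goes to the hypothesis `hyp`,
  -- the other to the exceptional graphs.
  ke≤ : k * e ≤ suc k * g
  ke≤ = *-cancelˡ-≤ 2 (+-cancelʳ-≤ (2 * e) (2 * (k * e)) (2 * (suc k * g)) (begin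
    2 * (k * e) + 2 * e                      ≡⟨ solve 2
      (λ k e → con 2 :* (k :* e) :+ con 2 :* e := con 2 :* (con 1 :+ k) :* e) refl k e ⟩
    2 * suc k * e                            ≤⟨ hyp ⟩
    2 * suc k * s + e                        ≤⟨ +-monoˡ-≤ e (*-monoʳ-≤ (2 * suc k) s≤g+B) ⟩
    2 * suc k * (g + B) + e                  ≡⟨ cong (_+ e) (*-distribˡ-+ (2 * suc k) g B) ⟩
    2 * suc k * g + 2 * suc k * B + e        ≤⟨ +-monoˡ-≤ e (+-monoʳ-≤ (2 * suc k * g) KB≤e) ⟩
    2 * suc k * g + e + e                    ≡⟨ solve 3
      (λ k g e → con 2 :* (con 1 :+ k) :* g :+ e :+ e := con 2 :* ((con 1 :+ k) :* g) :+ con 2 :* e) refl k g e ⟩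
    2 * (suc k * g) + 2 * e                  ∎))

-- Transfer from a class to its class of complements

module _ {C D : ∀ {n} → Graph n → Set}
  (C⇒D : ∀ {n} {G : Graph n} → C G → D (complement G))
  (D⇒C : ∀ {n} {G : Graph n} → D G → C (complement G))
  (many : ManyGraphs C) (wins : SavesCop C) (almost-all-D : AlmostAll D ChiEqOmega) where

  -- The threshold forces the half a of n to be at least 25 + k. This meets both demands of
  -- `codes-bound`, namely 24 ≤ a and 2(k + 1) ≤ 2a + 1.
  many-beyond-codes : ∀ k {n} → (25 + k) + (25 + k) ≤ n →
    ∃[ F ] (Distinct {n} F × All C F × 2 * suc k * (n ^ n * n ^ n) ≤ length F)
  many-beyond-codes k {n} n-large with a , r , refl , r≤1 ← halve n
    with F , F-distinct , F-C , F-length ← many a r =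
    F , F-distinct , F-C , subst (2 * suc k * _ ≤_) (≡-sym F-length) (codes-bound 24≤a n≤ K≤)
    where
    open ≤-Reasoning
    25+k≤a : 25 + k ≤ a
    25+k≤a = half-large r≤1 n-large
    24≤a : 24 ≤ a
    24≤a = ≤-trans (m≤m+n 24 (suc k)) (≤-trans (≤-reflexive (+-suc 24 k)) 25+k≤a)
    n≤ : a + (a + r) ≤ suc (a + a)
    n≤ = begin
      a + (a + r)  ≤⟨ +-monoʳ-≤ a (+-monoʳ-≤ a r≤1) ⟩
      a + (a + 1)  ≡⟨ cong (a +_) (+-comm a 1) ⟩
      a + suc a    ≡⟨ +-suc a a ⟩
      suc (a + a)  ∎
    K≤ : 2 * suc k ≤ suc (a + a)
    K≤ = begin
      2 * suc k      ≤⟨ *-monoʳ-≤ 2 (≤-trans (m≤n+m (suc k) 24) (≤-trans (≤-reflexive (+-suc 24 k)) 25+k≤a)) ⟩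
      2 * a          ≡⟨ cong (a +_) (+-identityʳ a) ⟩
      a + a          ≤⟨ n≤1+n (a + a) ⟩
      suc (a + a)    ∎

  -- A short `L` might consist of coded graphs only. Since `AlmostAll` does not ask for the good
  -- graphs to come from `L`, a longer list may replace it, and the longer of `L` and `F` also
  -- outweighs the codes.
  enlarge : ∀ k {n} → (25 + k) + (25 + k) ≤ n → (L : List (Graph n)) → Distinct L → All C L →
    ∃[ E ] (Distinct {n} E × All C E × length L ≤ length E × 2 * suc k * (n ^ n * n ^ n) ≤ length E)
  enlarge k n-large L L-distinct L-C
    with F , F-distinct , F-C , codes≤F ← many-beyond-codes k n-large
    with ≤-total (length L) (length F)
  ... | inj₁ L≤F = F , F-distinct , F-C , L≤F , codes≤F
  ... | inj₂ F≤L = L , L-distinct , L-C , ≤-refl , ≤-trans codes≤F F≤L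

  -- The hypothesis is applied to the complements of `E` with tolerance 1/(2(k + 1)). The graphs it
  -- returns are complemented back and split into those with a saved cop and the few coded ones.
  almost-all-C : AlmostAll C CopLessAlpha
  -- suc (k + suc (k + 0)) is 2 * suc k.
  almost-all-C k with N , hyp ← almost-all-D (k + suc (k + 0)) =
    N + ((25 + k) + (25 + k)) , λ n n-large L L-distinct L-C →
    let
      E , E-distinct , E-C , L≤E , codes≤E =
        enlarge k (≤-trans (m≤n+m _ N) n-large) L L-distinct L-C
      S , S-distinct , S-D , S-long = hyp n (≤-trans (m≤m+n N _) n-large) (map complement E)
        (complements-distinct E-distinct)
        (All.map⁺ (All.map C⇒D E-C))
      good , bad , good-distinct , bad-distinct , good-P , bad-coded , S-length , _ =
        partition {P = λ G → C G × CopLessAlpha G} {Q = Coded}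
          (complements-distinct S-distinct)
          (All.map⁺ (All.map classify S-D))
    in good , good-distinct , good-P ,
      proportion k L≤E codes≤E
        (≤-trans (≤-reflexive (trans (≡-sym (length-map complement S)) S-length))
          (+-monoʳ-≤ (length good) (coded-length bad bad-distinct bad-coded)))
        (subst (λ e → 2 * suc k * e ≤ 2 * suc k * length S + e) (length-map complement E) S-long)
    where
    classify : ∀ {n} {G : Graph n} → D G × ChiEqOmega G →
               (C (complement G) × CopLessAlpha (complement G)) ⊎ Coded (complement G)
    classify {G = G} (DG , χ≡ω) =
      map₁ (D⇒C DG ,_) (cop<α-or-coded {C} wins G (D⇒C DG) χ≡ω)

theorem1p4 : AlmostAll (Free threeK1) ChiEqOmega →
    AlmostAll (Free twoK2) ChiEqOmega →
    (ℓ : ℕ) → (ℓ ≡ 3 ⊎ ℓ ≡ 4) →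
    AlmostAll (Free (cycle ℓ)) CopLessAlpha
theorem1p4 threeK1-hyp _ _ (inj₁ refl) = almost-all-C {Free (cycle 3)} {Free threeK1}
  (λ {n} {G} → cycle3⇒threeK1 {n} {G}) (λ {n} {G} → threeK1⇒cycle3 {n} {G})
  many-cycle3-free cycle3-wins threeK1-hyp
theorem1p4 _ twoK2-hyp _ (inj₂ refl) = almost-all-C {Free (cycle 4)} {Free twoK2}
  (λ {n} {G} → cycle4⇒twoK2 {n} {G}) (λ {n} {G} → twoK2⇒cycle4 {n} {G})
  many-cycle4-free cycle4-wins twoK2-hyp
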